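{- Let $k\ge 1$ and let $f\colon \mathbb{F}_2^k\to\mathbb{F}_2$ be a Boolean function. Then $f$ is a potential $(k,n)$-lifting for all $n\geq k$ if and only if $f$ is an almost lifting. Moreover, if $f$ is an almost lifting, then $\ell(f)\leq 2^{k-1}$.
   Context: A Boolean function $f\colon\mathbb{F}_2^k\to\mathbb{F}_2$ has diameter $k$ if its values depend on both $x_1$ and $x_k$ (a function depends on $x_i$ if changing the $i$-th input bit changes the value for at least one input). For $m\geq k$ let $F_{(m)}\colon\mathbb{F}_2^m\to\mathbb{F}_2^{m-k+1}$ be the induced map without wrap-around, $$F_{(m)}(x_1,\dotsc,x_m)=\big(f(x_1,\dotsc,x_k),f(x_2,\dotsc,x_{k+1}),\dotsc,f(x_{m-k+1},\dotsc,x_m)\big).$$ $F_{(m)}$ is balanced if $|F_{(m)}^{ -1}(y)|=2^{k-1}$ for all $y\in\mathbb{F}_2^{m-k+1}$. For $n\ge k$, $f$ is a potential $(k,n)$-lifting if $f$ has diameter $k$ and $F_{(m)}$ is balanced for every $m$ with $k\leq m\leq n$. For $n\geq k$ let $F\colon\mathbb{F}_2^n\to\mathbb{F}_2^n$ be the induced shift-invariant map $$F(x_1,\dotsc,x_n)=\big(f(x_1,x_2,\dotsc,x_k),f(x_2,x_3,\dotsc,x_{k+1}),\dotsc,f(x_n,x_1,\dotsc,x_{k-1})\big)$$ (indices cyclic modulo $n$). Set $\ell_n(f)=\max_{y\in\mathbb{F}_2^n}|F^{ -1}(y)|$ and $\ell(f)=\sup_{n\geq k}\ell_n(f)$. The function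 $f$ is an almost lifting if $f$ has diameter $k$ and $\ell(f)<\infty$. -}

module Defs where

open import Data.Bool.Base using (Bool; true; false; not)
import Data.Bool.Properties as Bool
open import Data.Fin.Base using (Fin; toℕ; fromℕ<)
open import Data.Fin.Properties using (toℕ<n; nonZeroIndex)
open import Data.List.Base as List using (List; _++_)
open import Data.List.Extrema.Nat using (max)
open import Data.List.Membership.Propositional using (_∈_)
open import Data.List.Membership.Propositional.Properties
  using (∈-map⁺; ∈-map⁻; ∈-++⁺ˡ; ∈-++⁺ʳ)
open import Data.List.Relation.Unary.All as All using ()
open import Data.List.Relation.Unary.AllPairs as AllPairs using ()
open import Data.List.Relation.Unary.Any using (here)
open import Data.List.Relation.Unary.Unique.Propositional using (Unique)
import Data.List.Relation.Unary.Unique.Propositional.Properties as Unique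
open import Data.Nat.Base
open import Data.Nat.DivMod using (_mod_)
open import Data.Nat.Properties
open import Data.Product.Base using (∃; _×_; _,_)
open import Data.Vec.Base using (Vec; []; _∷_; lookup; tabulate; _[_]%=_)
import Data.Vec.Properties as Vec
open import Relation.Binary.PropositionalEquality

𝔽₂^ : ℕ → Set
𝔽₂^ n = Vec Bool n

allPoints : ∀ n → List (𝔽₂^ n)
allPoints zero    = List.[ [] ]
allPoints (suc n) = List.map (false ∷_) (allPoints n) ++ List.map (true ∷_) (allPoints n)

-- Together, the next two lemmas say that filtering allPoints computes
-- cardinalities of subsets of 𝔽₂^ n.
∈-allPoints : ∀ {n} (x : 𝔽₂^ n) → x ∈ allPoints n
∈-allPoints []          = here refl
∈-allPoints (false ∷ x) = ∈-++⁺ˡ (∈-map⁺ (false ∷_) (∈-allPoints x))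
∈-allPoints (true  ∷ x) = ∈-++⁺ʳ _ (∈-map⁺ (true ∷_) (∈-allPoints x))

allPoints-unique : ∀ n → Unique (allPoints n)
allPoints-unique zero    = All.[] AllPairs.∷ AllPairs.[]
allPoints-unique (suc n) = Unique.++⁺
  (Unique.map⁺ Vec.∷-injectiveʳ (allPoints-unique n))
  (Unique.map⁺ Vec.∷-injectiveʳ (allPoints-unique n))
  λ (p , q) → disjoint (∈-map⁻ _ p) (∈-map⁻ _ q)
  where
  open import Data.Empty using (⊥)
  disjoint : ∀ {v : 𝔽₂^ (suc n)} →
             ∃ (λ x → x ∈ allPoints n × v ≡ false ∷ x) →
             ∃ (λ x → x ∈ allPoints n × v ≡ true ∷ x) → ⊥
  disjoint (_ , _ , refl) (_ , _ , ())

∣_⁻¹[_]∣ : ∀ {m n} → (𝔽₂^ m → 𝔽₂^ n) → 𝔽₂^ n → ℕ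
∣_⁻¹[_]∣ {m} G y = List.length (List.filter (λ x → Vec.≡-dec Bool._≟_ (G x) y) (allPoints m))

DependsOn : ∀ {k} → (𝔽₂^ k → Bool) → Fin k → Set
DependsOn f i = ∃ λ x → f (x [ i ]%= not) ≢ f x

firstIndex lastIndex : ∀ k .{{_ : NonZero k}} → Fin k
firstIndex k = fromℕ< {0} (>-nonZero⁻¹ k)
lastIndex  k = fromℕ< {pred k} (≤-reflexive (suc-pred k))

HasDiameter : ∀ k .{{_ : NonZero k}} → (𝔽₂^ k → Bool) → Set
HasDiameter k f = DependsOn f (firstIndex k) × DependsOn f (lastIndex k)

windowBound : ∀ {k m} → k ≤ m → (i : Fin (m ∸ k + 1)) (j : Fin k) → toℕ i + toℕ j < m
windowBound {k} {m} k≤m i j = begin-strict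
  toℕ i + toℕ j  <⟨ +-mono-≤-< i≤m∸k (toℕ<n j) ⟩
  m ∸ k + k      ≡⟨ m∸n+n≡m k≤m ⟩
  m              ∎
  where
  open ≤-Reasoning
  i≤m∸k : toℕ i ≤ m ∸ k
  i≤m∸k = s≤s⁻¹ (subst (toℕ i <_) (+-comm (m ∸ k) 1) (toℕ<n i))

-- The map F₍ₘ₎ without wrap-around; coordinates are indexed from 0.
localMap : ∀ {k} → (𝔽₂^ k → Bool) → ∀ m → .(k ≤ m) → 𝔽₂^ m → 𝔽₂^ (m ∸ k + 1)
localMap f m k≤m x =
  tabulate λ i → f (tabulate λ j → lookup x (fromℕ< (windowBound k≤m i j)))

-- The shift-invariant map F, with coordinates indexed from 0 modulo n.
cyclicMap : ∀ {k} → (𝔽₂^ k → Bool) → ∀ n → 𝔽₂^ n → 𝔽₂^ n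
cyclicMap f n x =
  tabulate λ i → f (tabulate λ j → lookup x (_mod_ (toℕ i + toℕ j) n {{nonZeroIndex i}}))

Balanced : ∀ {k} → (𝔽₂^ k → Bool) → ∀ m → .(k ≤ m) → Set
Balanced {k} f m k≤m = ∀ y → ∣ localMap f m k≤m ⁻¹[ y ]∣ ≡ 2 ^ (k ∸ 1)

PotentialLifting : ∀ k .{{_ : NonZero k}} → ℕ → (𝔽₂^ k → Bool) → Set
PotentialLifting k n f =
  HasDiameter k f × (∀ m → (k≤m : k ≤ m) → m ≤ n → Balanced f m k≤m)

ℓ[_] : ∀ {k} → ℕ → (𝔽₂^ k → Bool) → ℕ
ℓ[ n ] f = max 0 (List.map (λ y → ∣ cyclicMap f n ⁻¹[ y ]∣) (allPoints n))

-- ℓ f = sup_{n ≥ k} ℓ[ n ] f lives in ℕ ∪ {∞}. Such a supremum is not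
-- constructively an element of a datatype ℕ ⊎ {∞}, so it is handled through the
-- property defining a supremum: ℓ f ≤ c iff c bounds every term, and ℓ f < ∞ iff
-- ℓ f ≤ c for some natural number c.
infix 4 ℓ_≤_ ℓ_<∞

ℓ_≤_ : ∀ {k} → (𝔽₂^ k → Bool) → ℕ → Set
ℓ_≤_ {k} f c = ∀ n → k ≤ n → ℓ[ n ] f ≤ c

ℓ_<∞ : ∀ {k} → (𝔽₂^ k → Bool) → Set
ℓ f <∞ = ∃ λ c → ℓ f ≤ c

AlmostLifting : ∀ k .{{_ : NonZero k}} → (𝔽₂^ k → Bool) → Set
AlmostLifting k f = HasDiameter k f × ℓ f <∞

{-# OPTIONS --safe #-}

-- Write N(y) for the number of preimages of y under F₍ₘ₎. If F₍ₙ₊ₖ₋₁₎ is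
-- balanced, then ℓₙ(f) ≤ 2^(k-1), because repeating the first k - 1 letters of a
-- cyclic word embeds the F-fibre of y into the F₍ₙ₊ₖ₋₁₎-fibre of y.
-- Conversely, concatenating p arbitrary F₍ₘ₎-preimages of y gives N(y)^p cyclic
-- words of length pm whose images under F consist of p blocks beginning with y,
-- leaving 2^(k-1) choices per block; hence N(y)^p ≤ ℓ(f) · 2^(p(k-1)) for all
-- p ≥ 1, which forces N(y) ≤ 2^(k-1). As N has mean 2^(k-1), it is constant.
module Submission where

open import Defs
open import Data.Bool.Base using (Bool; true; false)
import Data.Bool.Properties as Bool
open import Data.Fin.Base as Fin using (Fin; zero; suc; toℕ; fromℕ<; combine; _↑ˡ_)
open import Data.Fin.Properties
  using (toℕ<n; toℕ-injective; toℕ-fromℕ<; toℕ-combine; toℕ-↑ˡ; toℕ-cast; injective⇒≤; nonZeroIndex)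
open import Data.List.Base as List using (List; []; _∷_; _++_; length; concatMap; cartesianProductWith)
open import Data.List.Extrema.Nat using (xs≤max; max≤v⁺)
open import Data.List.Membership.Propositional using (_∈_; lose)
open import Data.List.Membership.Propositional.Properties
  using (∈-map⁺; ∈-map⁻; ∈-concatMap⁺; ∈-filter⁺; ∈-filter⁻; ∈-lookup; ∈-cartesianProductWith⁺; ∈-cartesianProductWith⁻)
open import Data.List.Membership.Setoid.Properties using (index-injective)
open import Data.List.Properties using (length-++; length-map)
open import Data.List.Relation.Unary.All as All using ()
import Data.List.Relation.Unary.All.Properties as All
open import Data.List.Relation.Unary.AllPairs as AllPairs using ()
open import Data.List.Relation.Unary.Any using (here; there; index)
open import Data.List.Relation.Unary.Unique.Propositional using (Unique)
import Data.List.Relation.Unary.Unique.Propositional.Properties as Unique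
open import Data.Nat.Base
  using (ℕ; zero; suc; NonZero; >-nonZero; >-nonZero⁻¹; _≤_; z≤n; s≤s; _^_; _∸_; _+_; _*_; _%_)
open import Data.Nat.DivMod using (_mod_; m%n<n; m<n⇒m%n≡m)
open import Data.Nat.ListAction using (sum)
open import Data.Nat.Properties
open import Data.Nat.Tactic.RingSolver using (solve-∀)
open import Data.Product.Base using (∃; _×_; _,_; proj₁; proj₂)
open import Data.Vec.Base as Vec using (Vec; []; _∷_; lookup; tabulate; concat; group; cast)
import Data.Vec.Properties as Vec
open import Function.Base using (_∘_)
open import Function.Bundles using (_⇔_; mk⇔)
open import Relation.Binary.PropositionalEquality
open import Relation.Nullary.Decidable using (yes; no)
open import Relation.Nullary.Negation using (contradiction)

private variable
  A B C : Set
  k m n r q : ℕ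

-- Counting with duplicate-free lists

lookup-Unique-injective : {xs : List A} → Unique xs → ∀ {i j} →
  List.lookup xs i ≡ List.lookup xs j → i ≡ j
lookup-Unique-injective (_ AllPairs.∷ _)  {zero}  {zero}  _  = refl
lookup-Unique-injective (x∉ AllPairs.∷ _) {zero}  {suc j} eq = contradiction eq (All.lookup x∉ (∈-lookup j))
lookup-Unique-injective (x∉ AllPairs.∷ _) {suc i} {zero}  eq = contradiction (sym eq) (All.lookup x∉ (∈-lookup i))
lookup-Unique-injective (_ AllPairs.∷ u)  {suc i} {suc j} eq = cong suc (lookup-Unique-injective u eq)

-- Pigeonhole: sending a position in `xs` to the index of its entry in `ys` is an injection between
-- finite sets.
Unique∧⊆⇒length≤ : {xs ys : List A} → Unique xs → (∀ {x} → x ∈ xs → x ∈ ys) → length xs ≤ length ys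
Unique∧⊆⇒length≤ {A = A} u xs⊆ys = injective⇒≤ {f = λ i → index (xs⊆ys (∈-lookup i))} λ {i} {j} eq →
  lookup-Unique-injective u (index-injective (setoid A) (xs⊆ys (∈-lookup i)) (xs⊆ys (∈-lookup j)) eq)

length-concatMap : (g : A → List B) (xs : List A) → length (concatMap g xs) ≡ sum (List.map (length ∘ g) xs)
length-concatMap g []       = refl
length-concatMap g (x ∷ xs) = trans (length-++ (g x)) (cong (length (g x) +_) (length-concatMap g xs))

length-cartesianProductWith : (g : A → B → C) (xs : List A) (ys : List B) →
  length (cartesianProductWith g xs ys) ≡ length xs * length ys
length-cartesianProductWith g []       ys = refl
length-cartesianProductWith g (x ∷ xs) ys = trans (length-++ (List.map (g x) ys))
  (cong₂ _+_ (length-map (g x) ys) (length-cartesianProductWith g xs ys))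

sum-map-≤ : (g : A → ℕ) {c : ℕ} → (∀ x → g x ≤ c) → ∀ xs → sum (List.map g xs) ≤ length xs * c
sum-map-≤ g g≤c []       = z≤n
sum-map-≤ g g≤c (x ∷ xs) = +-mono-≤ (g≤c x) (sum-map-≤ g g≤c xs)

-- A deficit at one entry cannot be made up elsewhere. Bounding the tail and cancelling settles the
-- head; bounding the head by `c` and cancelling passes the hypothesis on to the tail.
sum-map-maximal⇒constant : (g : A → ℕ) {c : ℕ} → (∀ x → g x ≤ c) → ∀ xs →
  length xs * c ≤ sum (List.map g xs) → ∀ {x} → x ∈ xs → g x ≡ c
sum-map-maximal⇒constant g {c} g≤c (x ∷ xs) le (here refl) = ≤-antisym (g≤c x)
  (+-cancelʳ-≤ (length xs * c) c (g x) (≤-trans le (+-monoʳ-≤ (g x) (sum-map-≤ g g≤c xs))))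
sum-map-maximal⇒constant g {c} g≤c (x ∷ xs) le (there x∈) = sum-map-maximal⇒constant g g≤c xs
  (+-cancelˡ-≤ c _ _ (≤-trans le (+-monoˡ-≤ (sum (List.map g xs)) (g≤c x)))) x∈

-- Comparison of exponential growth

-- Bernoulli's inequality 1 + p/b ≤ (1 + 1/b)^p, multiplied by b^(p+1) to stay within the natural
-- numbers.
bernoulli : ∀ b p → (p + b) * b ^ p ≤ b * suc b ^ p
bernoulli b zero    = ≤-refl
bernoulli b (suc p) = begin
  (suc p + b) * (b * b ^ p)       ≡⟨ *-assoc (suc p + b) b (b ^ p) ⟨
  (suc p + b) * b * b ^ p         ≤⟨ *-monoˡ-≤ (b ^ p) le ⟩
  suc b * (p + b) * b ^ p         ≡⟨ *-assoc (suc b) (p + b) (b ^ p) ⟩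
  suc b * ((p + b) * b ^ p)       ≤⟨ *-monoʳ-≤ (suc b) (bernoulli b p) ⟩
  suc b * (b * suc b ^ p)         ≡⟨ exchange (suc b) b (suc b ^ p) ⟩
  b * (suc b * suc b ^ p)         ∎
  where
  open ≤-Reasoning
  exchange : ∀ x y z → x * (y * z) ≡ y * (x * z)
  exchange = solve-∀
  expand : ∀ p b → suc b * (p + b) ≡ (suc p + b) * b + p
  expand = solve-∀
  le : (suc p + b) * b ≤ suc b * (p + b)
  le = ≤-trans (m≤m+n _ p) (≤-reflexive (sym (expand p b)))

geometric-bound⇒≤ : ∀ a b c .{{_ : NonZero b}} → (∀ p .{{_ : NonZero p}} → a ^ p ≤ b ^ p * c) → a ≤ b
geometric-bound⇒≤ a b c bound with a ≤? b
... | yes a≤b = a≤b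
... | no  a≰b = contradiction le (<⇒≱ (s≤s (m≤m+n (b * c) b)))
  where
  open ≤-Reasoning
  -- If a > b, Bernoulli makes (a/b)^p at least 1 + p/b. This `p` is positive, as `bound` requires,
  -- and large enough that 1 + p/b > c.
  p : ℕ
  p = suc (b * c)
  le : p + b ≤ b * c
  le = *-cancelʳ-≤ (p + b) (b * c) (b ^ p) {{m^n≢0 b p}} (begin
    (p + b) * b ^ p  ≤⟨ bernoulli b p ⟩
    b * suc b ^ p    ≤⟨ *-monoʳ-≤ b (^-monoˡ-≤ p (≰⇒> a≰b)) ⟩
    b * a ^ p        ≤⟨ *-monoʳ-≤ b (bound p) ⟩
    b * (b ^ p * c)  ≡⟨ cong (b *_) (*-comm (b ^ p) c) ⟩
    b * (c * b ^ p)  ≡⟨ *-assoc b c (b ^ p) ⟨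
    b * c * b ^ p    ∎)

-- Fibres of maps between Boolean cubes

length-allPoints : ∀ n → length (allPoints n) ≡ 2 ^ n
length-allPoints zero    = refl
length-allPoints (suc n) = begin
  length (List.map (false ∷_) ps ++ List.map (true ∷_) ps)           ≡⟨ length-++ (List.map (false ∷_) ps) ⟩
  length (List.map (false ∷_) ps) + length (List.map (true ∷_) ps)   ≡⟨ cong₂ _+_ (length-map _ ps) (length-map _ ps) ⟩
  length ps + length ps                                              ≡⟨ cong (length ps +_) (+-identityʳ (length ps)) ⟨
  2 * length ps                                                      ≡⟨ cong (2 *_) (length-allPoints n) ⟩
  2 ^ suc n                                                          ∎
  where
  open ≡-Reasoning
  ps = allPoints n

-- The list whose length is, by definition, `∣ G ⁻¹[ y ]∣`.
fibre : (𝔽₂^ m → 𝔽₂^ n) → 𝔽₂^ n → List (𝔽₂^ m)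
fibre {m} G y = List.filter (λ x → Vec.≡-dec Bool._≟_ (G x) y) (allPoints m)

∈-fibre⁺ : (G : 𝔽₂^ m → 𝔽₂^ n) {x : 𝔽₂^ m} {y : 𝔽₂^ n} → G x ≡ y → x ∈ fibre G y
∈-fibre⁺ G {x} {y} = ∈-filter⁺ (λ x → Vec.≡-dec Bool._≟_ (G x) y) (∈-allPoints x)

∈-fibre⁻ : (G : 𝔽₂^ m → 𝔽₂^ n) {x : 𝔽₂^ m} {y : 𝔽₂^ n} → x ∈ fibre G y → G x ≡ y
∈-fibre⁻ {m} G {y = y} = proj₂ ∘ ∈-filter⁻ (λ x → Vec.≡-dec Bool._≟_ (G x) y) {xs = allPoints m}

fibre-unique : (G : 𝔽₂^ m → 𝔽₂^ n) (y : 𝔽₂^ n) → Unique (fibre G y)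
fibre-unique {m} G y = Unique.filter⁺ _ (allPoints-unique m)

-- Each x lies in the fibre over `G x`, so `xs` is contained in the concatenation of the fibres over
-- `ys`.
length≤sum-fibres : (G : 𝔽₂^ m → 𝔽₂^ n) {xs : List (𝔽₂^ m)} (ys : List (𝔽₂^ n)) → Unique xs →
  (∀ {x} → x ∈ xs → G x ∈ ys) → length xs ≤ sum (List.map ∣ G ⁻¹[_]∣ ys)
length≤sum-fibres G ys u G∈ = ≤-trans
  (Unique∧⊆⇒length≤ u λ x∈ → ∈-concatMap⁺ (fibre G) (lose (G∈ x∈) (∈-fibre⁺ G refl)))
  (≤-reflexive (length-concatMap (fibre G) ys))

∣⁻¹∣-≤ : (G : 𝔽₂^ m → 𝔽₂^ n) (H : 𝔽₂^ r → 𝔽₂^ q) (e : 𝔽₂^ m → 𝔽₂^ r) →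
  (∀ {x x′} → e x ≡ e x′ → x ≡ x′) → ∀ {y z} → (∀ x → G x ≡ y → H (e x) ≡ z) →
  ∣ G ⁻¹[ y ]∣ ≤ ∣ H ⁻¹[ z ]∣
∣⁻¹∣-≤ G H e e-inj {y} {z} e-maps = subst (_≤ ∣ H ⁻¹[ z ]∣) (length-map e (fibre G y))
  (Unique∧⊆⇒length≤ (Unique.map⁺ e-inj (fibre-unique G y)) sub)
  where
  sub : ∀ {w} → w ∈ List.map e (fibre G y) → w ∈ fibre H z
  sub w∈ with _ , x∈ , refl ← ∈-map⁻ e w∈ = ∈-fibre⁺ H (e-maps _ (∈-fibre⁻ G x∈))

-- Words, their concatenations and their extensions

lookup-toℕ : (x : Vec A n) {i j : Fin n} → toℕ i ≡ toℕ j → lookup x i ≡ lookup x j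
lookup-toℕ x = cong (lookup x) ∘ toℕ-injective

lookup-ext : {x y : Vec A n} → (∀ i → lookup x i ≡ lookup y i) → x ≡ y
lookup-ext {x = x} {y} eq = trans (sym (Vec.tabulate∘lookup x)) (trans (Vec.tabulate-cong eq) (Vec.tabulate∘lookup y))

toℕ-mod : ∀ a n .{{_ : NonZero n}} → toℕ (a mod n) ≡ a % n
toℕ-mod a n = toℕ-fromℕ< (m%n<n a n)

-- Kept as flat words of length `p * m`, so that `cyclicMap` applies to them directly.
concatenations : List (Vec A m) → ∀ p → List (Vec A (p * m))
concatenations xs zero    = [] ∷ []
concatenations xs (suc p) = cartesianProductWith Vec._++_ xs (concatenations xs p)

length-concatenations : (xs : List (Vec A m)) → ∀ p → length (concatenations xs p) ≡ length xs ^ p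
length-concatenations xs zero    = refl
length-concatenations xs (suc p) = trans (length-cartesianProductWith Vec._++_ xs (concatenations xs p))
  (cong (length xs *_) (length-concatenations xs p))

-- All blocks have the same length, so a word determines its blocks.
concatenations-unique : {xs : List (Vec A m)} → Unique xs → ∀ p → Unique (concatenations xs p)
concatenations-unique u zero    = All.[] AllPairs.∷ AllPairs.[]
concatenations-unique u (suc p) =
  Unique.cartesianProductWith⁺ Vec._++_ (Vec.++-injective _ _) u (concatenations-unique u p)

∈-concatenations⁺ : {xs : List (Vec A m)} → ∀ {p} (xss : Vec (Vec A m) p) →
  (∀ s → lookup xss s ∈ xs) → concat xss ∈ concatenations xs p
∈-concatenations⁺ []         _  = here refl
∈-concatenations⁺ (x ∷ xss) x∈ = ∈-cartesianProductWith⁺ Vec._++_ (x∈ zero) (∈-concatenations⁺ xss (x∈ ∘ suc))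

∈-concatenations⁻ : {xs : List (Vec A m)} → ∀ p {x} → x ∈ concatenations xs p →
  ∃ λ (xss : Vec (Vec A m) p) → x ≡ concat xss × (∀ s → lookup xss s ∈ xs)
∈-concatenations⁻ zero (here refl) = [] , refl , λ ()
∈-concatenations⁻ {xs = xs} (suc p) x∈
  with x₀ , _ , x₀∈ , x₁∈ , refl ← ∈-cartesianProductWith⁻ Vec._++_ xs (concatenations xs p) x∈
  with xss , refl , xss∈ ← ∈-concatenations⁻ p x₁∈
  = x₀ ∷ xss , refl , λ { zero → x₀∈ ; (suc s) → xss∈ s }

-- These are the possible image blocks: a prescribed beginning `y` and `q` free letters. The cast is
-- there because block lengths such as `m ∸ k + 1 + (k ∸ 1)` equal `m` only propositionally.
extensions : .(r + q ≡ m) → 𝔽₂^ r → List (𝔽₂^ m)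
extensions {q = q} eq y = List.map (λ u → cast eq (y Vec.++ u)) (allPoints q)

length-extensions : .(eq : r + q ≡ m) (y : 𝔽₂^ r) → length (extensions eq y) ≡ 2 ^ q
length-extensions {q = q} eq y = trans (length-map _ (allPoints q)) (length-allPoints q)

-- Agreement is stated through `toℕ` because the positions lie in different `Fin` types. Splitting
-- `z` after `r` letters identifies its first part with `y`.
∈-extensions⁺ : (eq : r + q ≡ m) (y : 𝔽₂^ r) (z : 𝔽₂^ m) →
  (∀ i j → toℕ i ≡ toℕ j → lookup z j ≡ lookup y i) → z ∈ extensions eq y
∈-extensions⁺ {r} {q} refl y z agree with y′ , u , refl ← Vec.splitAt r z
  rewrite lookup-ext {x = y} {y′} (λ i → trans (sym (agree i (i ↑ˡ q) (sym (toℕ-↑ˡ i q)))) (Vec.lookup-++ˡ y′ u i))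
  = subst (_∈ extensions refl y′) (Vec.cast-is-id refl (y′ Vec.++ u)) (∈-map⁺ _ (∈-allPoints u))

-- Windows of the local and cyclic maps

lookup-localMap : (f : 𝔽₂^ k → Bool) (k≤m : k ≤ m) (x : 𝔽₂^ m) (i : Fin (m ∸ k + 1)) →
  lookup (localMap f m k≤m x) i ≡ f (tabulate λ j → lookup x (fromℕ< (windowBound k≤m i j)))
lookup-localMap f k≤m x i = Vec.lookup∘tabulate _ i

lookup-cyclicMap : (f : 𝔽₂^ k → Bool) .{{_ : NonZero n}} (x : 𝔽₂^ n) (i : Fin n) →
  lookup (cyclicMap f n x) i ≡ f (tabulate λ j → lookup x ((toℕ i + toℕ j) mod n))
lookup-cyclicMap f x i = Vec.lookup∘tabulate _ i

-- A window starting at one of the first m - k + 1 positions of block `s` ends inside that block, so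
-- it neither meets the next block nor wraps around. Here `j` is `i` regarded as a position in the
-- whole block.
lookup-cyclicMap-concat : (f : 𝔽₂^ k → Bool) (k≤m : k ≤ m) → ∀ {p} (xss : Vec (𝔽₂^ m) p)
  (s : Fin p) (i : Fin (m ∸ k + 1)) (j : Fin m) → toℕ i ≡ toℕ j →
  lookup (cyclicMap f (p * m) (concat xss)) (combine s j) ≡ lookup (localMap f m k≤m (lookup xss s)) i
lookup-cyclicMap-concat {k} {m} f k≤m {p} xss s i j i≡j = begin
  lookup (cyclicMap f (p * m) (concat xss)) (combine s j)
    ≡⟨ lookup-cyclicMap f (concat xss) (combine s j) ⟩
  f (tabulate λ t → lookup (concat xss) ((toℕ (combine s j) + toℕ t) mod (p * m)))
    ≡⟨ cong f (Vec.tabulate-cong λ t → trans (lookup-toℕ (concat xss) (position t)) (Vec.lookup-concat xss s (w t))) ⟩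
  f (tabulate λ t → lookup (lookup xss s) (w t))
    ≡⟨ lookup-localMap f k≤m (lookup xss s) i ⟨
  lookup (localMap f m k≤m (lookup xss s)) i ∎
  where
  open ≡-Reasoning
  instance
    pm≢0 : NonZero (p * m)
    pm≢0 = nonZeroIndex (combine s j)
  w : Fin k → Fin m
  w t = fromℕ< (windowBound k≤m i t)
  offset : ∀ t → toℕ (combine s j) + toℕ t ≡ toℕ (combine s (w t))
  offset t = begin
    toℕ (combine s j) + toℕ t     ≡⟨ cong (_+ toℕ t) (toℕ-combine s j) ⟩
    m * toℕ s + toℕ j + toℕ t     ≡⟨ +-assoc (m * toℕ s) (toℕ j) (toℕ t) ⟩
    m * toℕ s + (toℕ j + toℕ t)   ≡⟨ cong (λ a → m * toℕ s + (a + toℕ t)) i≡j ⟨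
    m * toℕ s + (toℕ i + toℕ t)   ≡⟨ cong (m * toℕ s +_) (toℕ-fromℕ< (windowBound k≤m i t)) ⟨
    m * toℕ s + toℕ (w t)         ≡⟨ toℕ-combine s (w t) ⟨
    toℕ (combine s (w t))         ∎
  position : ∀ t → toℕ ((toℕ (combine s j) + toℕ t) mod (p * m)) ≡ toℕ (combine s (w t))
  position t = begin
    toℕ ((toℕ (combine s j) + toℕ t) mod (p * m))   ≡⟨ toℕ-mod (toℕ (combine s j) + toℕ t) (p * m) ⟩
    (toℕ (combine s j) + toℕ t) % (p * m)           ≡⟨ cong (_% (p * m)) (offset t) ⟩
    toℕ (combine s (w t)) % (p * m)                 ≡⟨ m<n⇒m%n≡m (toℕ<n (combine s (w t))) ⟩
    toℕ (combine s (w t))                           ∎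

∣cyclicMap⁻¹∣≤ℓ : (f : 𝔽₂^ k → Bool) → ∀ n y → ∣ cyclicMap f n ⁻¹[ y ]∣ ≤ ℓ[ n ] f
∣cyclicMap⁻¹∣≤ℓ f n y = All.lookup (xs≤max 0 (List.map ∣ cyclicMap f n ⁻¹[_]∣ (allPoints n)))
  (∈-map⁺ ∣ cyclicMap f n ⁻¹[_]∣ (∈-allPoints y))

-- The `k ∸ 1` remaining positions of a block are those whose windows run past its end; they are the
-- free letters of an image block.
outputLength+k∸1 : ∀ k .{{_ : NonZero k}} {m} → k ≤ m → m ∸ k + 1 + (k ∸ 1) ≡ m
outputLength+k∸1 k {m} k≤m = begin
  m ∸ k + 1 + (k ∸ 1)     ≡⟨ +-assoc (m ∸ k) 1 (k ∸ 1) ⟩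
  m ∸ k + suc (k ∸ 1)     ≡⟨ cong (m ∸ k +_) (suc-pred k) ⟩
  m ∸ k + k               ≡⟨ m∸n+n≡m k≤m ⟩
  m                       ∎
  where open ≡-Reasoning

-- Finite ℓ implies balancedness

module _ .{{_ : NonZero k}} (f : 𝔽₂^ k → Bool) where

  cyclicMap-concat∈ : (k≤m : k ≤ m) → ∀ y {p} (xss : Vec (𝔽₂^ m) p) →
    (∀ s → localMap f m k≤m (lookup xss s) ≡ y) →
    cyclicMap f (p * m) (concat xss) ∈ concatenations (extensions (outputLength+k∸1 k k≤m) y) p
  cyclicMap-concat∈ {m} k≤m y {p} xss outputs
    with zss , eq ← group p m (cyclicMap f (p * m) (concat xss))
    = subst (_∈ concatenations (extensions (outputLength+k∸1 k k≤m) y) p) (sym eq)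
        (∈-concatenations⁺ zss λ s → ∈-extensions⁺ (outputLength+k∸1 k k≤m) y (lookup zss s) λ i j i≡j → begin
          lookup (lookup zss s) j                                    ≡⟨ Vec.lookup-concat zss s j ⟨
          lookup (concat zss) (combine s j)                          ≡⟨ cong (λ z → lookup z (combine s j)) eq ⟨
          lookup (cyclicMap f (p * m) (concat xss)) (combine s j)    ≡⟨ lookup-cyclicMap-concat f k≤m xss s i j i≡j ⟩
          lookup (localMap f m k≤m (lookup xss s)) i                 ≡⟨ cong (λ z → lookup z i) (outputs s) ⟩
          lookup y i                                                 ∎)
    where open ≡-Reasoning

  -- Double counting: the left side counts concatenations of preimages, the factor before `c` counts
  -- their possible images, and each image is attained at most `c` times.
  ∣localMap⁻¹∣^p≤ : ∀ {c} → ℓ f ≤ c → (k≤m : k ≤ m) → ∀ y p .{{_ : NonZero p}} →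
    ∣ localMap f m k≤m ⁻¹[ y ]∣ ^ p ≤ (2 ^ (k ∸ 1)) ^ p * c
  ∣localMap⁻¹∣^p≤ {m} {c} ℓ≤c k≤m y p = begin
    length X ^ p
      ≡⟨ length-concatenations X p ⟨
    length (concatenations X p)
      ≤⟨ length≤sum-fibres (cyclicMap f (p * m)) (concatenations Y p)
           (concatenations-unique (fibre-unique (localMap f m k≤m) y) p) image∈ ⟩
    sum (List.map ∣ cyclicMap f (p * m) ⁻¹[_]∣ (concatenations Y p))
      -- The bound `ℓ≤c` speaks only of lengths at least `k`; since `p` is nonzero, k ≤ m ≤ p * m.
      ≤⟨ sum-map-≤ _ (λ z → ≤-trans (∣cyclicMap⁻¹∣≤ℓ f (p * m) z) (ℓ≤c (p * m) (m≤n⇒m≤o*n p k≤m))) (concatenations Y p) ⟩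
    length (concatenations Y p) * c
      ≡⟨ cong (_* c) (length-concatenations Y p) ⟩
    length Y ^ p * c
      ≡⟨ cong (λ a → a ^ p * c) (length-extensions (outputLength+k∸1 k k≤m) y) ⟩
    (2 ^ (k ∸ 1)) ^ p * c ∎
    where
    open ≤-Reasoning
    X Y : List (𝔽₂^ m)
    X = fibre (localMap f m k≤m) y
    Y = extensions (outputLength+k∸1 k k≤m) y
    image∈ : ∀ {x} → x ∈ concatenations X p → cyclicMap f (p * m) x ∈ concatenations Y p
    image∈ x∈ with xss , refl , xss∈ ← ∈-concatenations⁻ p x∈
      = cyclicMap-concat∈ k≤m y xss (∈-fibre⁻ (localMap f m k≤m) ∘ xss∈)

  ℓ<∞⇒balanced : ℓ f <∞ → (k≤m : k ≤ m) → Balanced f m k≤m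
  ℓ<∞⇒balanced {m} (c , ℓ≤c) k≤m y =
    sum-map-maximal⇒constant ∣ localMap f m k≤m ⁻¹[_]∣ fibre≤ (allPoints (m ∸ k + 1)) total (∈-allPoints y)
    where
    open ≤-Reasoning
    fibre≤ : ∀ z → ∣ localMap f m k≤m ⁻¹[ z ]∣ ≤ 2 ^ (k ∸ 1)
    fibre≤ z = geometric-bound⇒≤ _ (2 ^ (k ∸ 1)) c {{m^n≢0 2 (k ∸ 1)}} (∣localMap⁻¹∣^p≤ ℓ≤c k≤m z)
    -- The fibres cover all 2^m = 2^(m-k+1) · 2^(k-1) points, so their sizes average at least the
    -- upper bound `fibre≤`.
    total : length (allPoints (m ∸ k + 1)) * 2 ^ (k ∸ 1) ≤
            sum (List.map ∣ localMap f m k≤m ⁻¹[_]∣ (allPoints (m ∸ k + 1)))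
    total = begin
      length (allPoints (m ∸ k + 1)) * 2 ^ (k ∸ 1)
        ≡⟨ cong (_* 2 ^ (k ∸ 1)) (length-allPoints (m ∸ k + 1)) ⟩
      2 ^ (m ∸ k + 1) * 2 ^ (k ∸ 1)
        ≡⟨ ^-distribˡ-+-* 2 (m ∸ k + 1) (k ∸ 1) ⟨
      2 ^ (m ∸ k + 1 + (k ∸ 1))
        ≡⟨ cong (2 ^_) (outputLength+k∸1 k k≤m) ⟩
      2 ^ m
        ≡⟨ length-allPoints m ⟨
      length (allPoints m)
        ≤⟨ length≤sum-fibres (localMap f m k≤m) (allPoints (m ∸ k + 1)) (allPoints-unique m) (λ _ → ∈-allPoints _) ⟩
      sum (List.map ∣ localMap f m k≤m ⁻¹[_]∣ (allPoints (m ∸ k + 1))) ∎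

  -- Balancedness bounds ℓ

  balanced⇒∣cyclicMap⁻¹∣≤ : ∀ n .{{_ : NonZero n}} (k≤m : k ≤ n + (k ∸ 1)) → Balanced f (n + (k ∸ 1)) k≤m →
    ∀ y → ∣ cyclicMap f n ⁻¹[ y ]∣ ≤ 2 ^ (k ∸ 1)
  balanced⇒∣cyclicMap⁻¹∣≤ n k≤m balanced y = ≤-trans
    (∣⁻¹∣-≤ (cyclicMap f n) (localMap f (n + (k ∸ 1)) k≤m) unroll unroll-injective {z = cast n≡ y} unroll-maps)
    (≤-reflexive (balanced (cast n≡ y)))
    where
    open ≡-Reasoning
    unroll : 𝔽₂^ n → 𝔽₂^ (n + (k ∸ 1))
    unroll x = tabulate λ i → lookup x (toℕ i mod n)

    -- The output length of the local map equals `n` only propositionally, so `y` has to be cast.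
    n≡ : n ≡ n + (k ∸ 1) ∸ k + 1
    n≡ = sym (+-cancelʳ-≡ (k ∸ 1) _ _ (outputLength+k∸1 k k≤m))

    -- The first `n` letters of the unrolled word are `x` itself, which makes `unroll` injective.
    lookup-unroll : ∀ x (i : Fin n) → lookup (unroll x) (i ↑ˡ (k ∸ 1)) ≡ lookup x i
    lookup-unroll x i = trans (Vec.lookup∘tabulate _ (i ↑ˡ (k ∸ 1))) (lookup-toℕ x (begin
      toℕ (toℕ (i ↑ˡ (k ∸ 1)) mod n)   ≡⟨ toℕ-mod (toℕ (i ↑ˡ (k ∸ 1))) n ⟩
      toℕ (i ↑ˡ (k ∸ 1)) % n           ≡⟨ cong (_% n) (toℕ-↑ˡ i (k ∸ 1)) ⟩
      toℕ i % n                        ≡⟨ m<n⇒m%n≡m (toℕ<n i) ⟩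
      toℕ i                            ∎))

    unroll-injective : ∀ {x x′} → unroll x ≡ unroll x′ → x ≡ x′
    unroll-injective {x} {x′} eq = lookup-ext λ i → trans (sym (lookup-unroll x i))
      (trans (cong (λ z → lookup z (i ↑ˡ (k ∸ 1))) eq) (lookup-unroll x′ i))

    -- Position i + j of the unrolled word carries the letter of `x` at (i + j) mod n, exactly the
    -- one that the cyclic window reads.
    unroll-maps : ∀ x → cyclicMap f n x ≡ y → localMap f (n + (k ∸ 1)) k≤m (unroll x) ≡ cast n≡ y
    unroll-maps x refl = lookup-ext λ i → let i′ = Fin.cast (sym n≡) i in begin
      lookup (localMap f (n + (k ∸ 1)) k≤m (unroll x)) i
        ≡⟨ lookup-localMap f k≤m (unroll x) i ⟩
      f (tabulate λ j → lookup (unroll x) (fromℕ< (windowBound k≤m i j)))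
        ≡⟨ cong f (Vec.tabulate-cong λ j → trans
             (Vec.lookup∘tabulate (λ t → lookup x (toℕ t mod n)) (fromℕ< (windowBound k≤m i j)))
             (cong (λ a → lookup x (a mod n))
               (trans (toℕ-fromℕ< (windowBound k≤m i j)) (cong (_+ toℕ j) (sym (toℕ-cast (sym n≡) i)))))) ⟩
      f (tabulate λ j → lookup x ((toℕ i′ + toℕ j) mod n))
        ≡⟨ lookup-cyclicMap f x i′ ⟨
      lookup (cyclicMap f n x) i′
        ≡⟨ Vec.lookup-cast₁ n≡ (cyclicMap f n x) i ⟨
      lookup (cast n≡ (cyclicMap f n x)) i ∎

  -- Cyclic length `n` calls for balancedness at the longer length `n + (k ∸ 1)`, so the hypothesis
  -- is used beyond `n`. The argument `z≤n` covers the default 0 in the maximum.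
  potentialLifting⇒ℓ≤ : (∀ n → k ≤ n → PotentialLifting k n f) → ℓ f ≤ (2 ^ (k ∸ 1))
  potentialLifting⇒ℓ≤ lifting n k≤n = max≤v⁺ z≤n (All.map⁺ (All.universal
    (balanced⇒∣cyclicMap⁻¹∣≤ n {{n≢0}} k≤m (proj₂ (lifting (n + (k ∸ 1)) k≤m) _ k≤m ≤-refl)) (allPoints n)))
    where
    k≤m : k ≤ n + (k ∸ 1)
    k≤m = m≤n⇒m≤n+o (k ∸ 1) k≤n
    n≢0 : NonZero n
    n≢0 = >-nonZero (≤-trans (>-nonZero⁻¹ k) k≤n)

  almostLifting⇒potentialLifting : AlmostLifting k f → ∀ n → k ≤ n → PotentialLifting k n f
  almostLifting⇒potentialLifting (diameter , ℓ<∞) n k≤n = diameter , λ m k≤m _ → ℓ<∞⇒balanced ℓ<∞ k≤m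

theorem3p8 : ∀ (k : ℕ) .{{_ : NonZero k}} (f : 𝔽₂^ k → Bool) →
    ((∀ n → k ≤ n → PotentialLifting k n f) ⇔ AlmostLifting k f)
    × (AlmostLifting k f → ℓ f ≤ (2 ^ (k ∸ 1)))
theorem3p8 k f =
  -- The diameter condition is read off from the case n = k.
  mk⇔ (λ lifting → proj₁ (lifting k ≤-refl) , 2 ^ (k ∸ 1) , potentialLifting⇒ℓ≤ f lifting)
      (almostLifting⇒potentialLifting f)
  -- Passing through potential liftings improves an arbitrary finite bound to 2^(k-1).
  , λ almost → potentialLifting⇒ℓ≤ f (almostLifting⇒potentialLifting f almost)
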